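{- Let $V$ be a finite set with $n:=|V|$, and let $k$ be a positive integer. Let $\mathcal{F}\subseteq 2^V$ be the complement of a $k$-hierarchical lattice, and let $f:2^V\to\mathbb{Z}$ be a submodular function. Suppose that we are given an oracle for testing whether $X\in\mathcal{F}$ or not for any given $X\subseteq V$. Then a minimizer of $f$ over $\mathcal{F}$ can be obtained in $O(n^{2k}(\tau(n)+\gamma))$ time, where $\tau(n)$ denotes the time required for minimizing a submodular function on a ground set of size $n$, and $\gamma$ denotes the time required for one membership oracle query for $\mathcal{F}$.
   Context: A set function $f:2^V\to\mathbb{Z}$ is submodular if $f(X)+f(Y)\ge f(X\cup Y)+f(X\cap Y)$ for all $X,Y\subseteq V$. Submodular functions are accessed in the evaluation oracle model, i.e. through an oracle returning $f(X)$ for any given $X\subseteq V$. A family $\mathcal{H}\subseteq 2^V$ is a $k$-hierarchical lattice if there exists a chain of families $\emptyset=\mathcal{H}_0\subseteq\mathcal{H}_1\subseteq\cdots\subseteq\mathcal{H}_k=\mathcal{H}$ (where $\mathcal{H}_0$ is the empty family) such that for all $i=1,\ldots,k$ and all $X,Y\in\mathcal{H}_i\setminus\mathcal{H}_{i-1}$, either both $X\cup Y$ and $X\cap Y$ belong to $\mathcal{H}_i\setminus\mathcal{H}_{i-1}$, or at least one of $X\cup Y$, $X\cap Y$ belongs to $\mathcal{H}_{i-1}$. A family $\mathcal{F}\subseteq 2^V$ is the complement of a $k$-hierarchical lattice if $2^V\setminus\mathcal{F}$ is a $k$-hierarchical lattice. A minimizer of $f$ over a family $\mathcal{G}\subseteq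 2^V$ is a set $X\in\mathcal{G}$ with $f(X)\le f(Y)$ for all $Y\in\mathcal{G}$; the algorithm is required to output one whenever $\mathcal{G}$ is nonempty. -}

module Defs where

open import Data.Bool.Base using (Bool; true; false; _∧_; not; T; if_then_else_)
open import Data.Fin.Subset using (Subset; inside; outside; ⊤; ⊥; _∪_; _∩_; _─_)
open import Data.Integer.Base as ℤ using (ℤ; +_; 0ℤ; 1ℤ; ∣_∣)
open import Data.Nat.Base using (ℕ; zero; suc; _+_; _*_; _≤_; _<_; _≡ᵇ_)
open import Data.Product.Base using (Σ-syntax; _×_; _,_)
open import Data.Sum.Base using (_⊎_)
open import Data.Unit.Base as Unit using ()
open import Data.Vec.Base using ([]; _∷_)
open import Relation.Binary.PropositionalEquality.Core using (_≡_)
open import Relation.Nullary.Negation.Core using (¬_)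

private variable
  n : ℕ

------------------------------------------------------------------------
-- Set functions and set families
--
-- The ground set is V = Fin n.  Like `Subset n` itself, a family of
-- subsets of V is given by its characteristic function.

Submodular : (Subset n → ℤ) → Set
Submodular f = ∀ X Y → f (X ∪ Y) ℤ.+ f (X ∩ Y) ℤ.≤ f X ℤ.+ f Y

Family : ℕ → Set
Family n = Subset n → Bool

infix 4 _∈ᶠ_ _⊆ᶠ_
infixl 5 _∖_

_∈ᶠ_ : Subset n → Family n → Set
X ∈ᶠ 𝓖 = T (𝓖 X)

_⊆ᶠ_ : Family n → Family n → Set
𝓖 ⊆ᶠ 𝓗 = ∀ X → X ∈ᶠ 𝓖 → X ∈ᶠ 𝓗

_∖_ : Family n → Family n → Family n
(𝓖 ∖ 𝓗) X = 𝓖 X ∧ not (𝓗 X)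

powerset : Family n
powerset _ = true

Nonempty : Family n → Set
Nonempty {n} 𝓖 = Σ[ X ∈ Subset n ] X ∈ᶠ 𝓖

IsMinimizer : (Subset n → ℤ) → Family n → Subset n → Set
IsMinimizer f 𝓖 X = X ∈ᶠ 𝓖 × (∀ Y → Y ∈ᶠ 𝓖 → f X ℤ.≤ f Y)

-- Only the values chain 0, …, chain k are relevant.
record HierarchicalLattice (k : ℕ) (𝓗 : Family n) : Set where
  field
    chain     : ℕ → Family n
    bottom    : ∀ X → ¬ X ∈ᶠ chain 0
    increases : ∀ i → i < k → chain i ⊆ᶠ chain (suc i)
    top       : chain k ⊆ᶠ 𝓗 × 𝓗 ⊆ᶠ chain k
    uncross   : ∀ i → i < k → ∀ X Y →
                X ∈ᶠ chain (suc i) ∖ chain i →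
                Y ∈ᶠ chain (suc i) ∖ chain i →
                (X ∪ Y ∈ᶠ chain (suc i) ∖ chain i × X ∩ Y ∈ᶠ chain (suc i) ∖ chain i)
                ⊎ (X ∪ Y ∈ᶠ chain i ⊎ X ∩ Y ∈ᶠ chain i)

IsComplementOfHierarchicalLattice : ℕ → Family n → Set
IsComplementOfHierarchicalLattice k 𝓕 = HierarchicalLattice k (powerset ∖ 𝓕)

------------------------------------------------------------------------
-- Oracle algorithms
--
-- An algorithm is a finite program, not depending on n, for a random
-- access machine with two unbounded memories: one of integers and one of
-- subsets of V.  Integer operations, comparisons, memory accesses and
-- operations on single elements of a stored set take one time unit;
-- operations on whole sets take suc n time units.  The oracle for f can
-- be queried in all programs, the membership oracle only in those of
-- type `Program true` and `Algorithm true`.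

-- `via i` is the cell whose address is the (absolute) value of integer
-- cell i.
data Loc : Set where
  at via : ℕ → Loc

data IntExp : Set where
  int         : ℤ → IntExp
  groundSize  : IntExp
  get         : Loc → IntExp
  add sub mul : IntExp → IntExp → IntExp

data SetExp : Set where
  empty full             : SetExp
  get                    : Loc → SetExp
  singleton              : IntExp → SetExp
  union inter difference : SetExp → SetExp → SetExp

data Test : Set where
  leq      : IntExp → IntExp → Test
  contains : Loc → IntExp → Test

infix 3 _returning_

mutual

  data Program : Bool → Set where
    skip          : ∀ {b} → Program b
    setInt        : ∀ {b} → Loc → IntExp → Program b
    setSet        : ∀ {b} → Loc → SetExp → Program b
    insert delete : ∀ {b} → Loc → IntExp → Program b
    -- store the value of f at a set
    evaluate      : ∀ {b} → Loc → SetExp → Program b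
    seq           : ∀ {b} → Program b → Program b → Program b
    ifElse        : ∀ {b} → Test → Program b → Program b → Program b
    while         : ∀ {b} → Test → Program b → Program b
    -- `call x A q e` runs A as a subroutine, in a fresh memory of its
    -- own, and stores the set it returns in x.  An evaluation query of A
    -- at Z is answered by f(e[Z]), where e[Z] is e evaluated in the
    -- memory of the caller with set cell q holding Z.
    call          : ∀ {b} → Loc → Algorithm false → ℕ → SetExp → Program b
    -- store 1 or 0, according to whether a set belongs to the family
    member        : Loc → SetExp → Program true

  record Algorithm (b : Bool) : Set where
    inductive
    constructor _returning_
    field
      body   : Program b
      output : SetExp

------------------------------------------------------------------------
-- Memory and expressions

record Memory (n : ℕ) : Set where
  constructor mem
  field
    ints : ℕ → ℤ
    sets : ℕ → Subset n

open Memory public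

initial : Memory n
initial = mem (λ _ → 0ℤ) (λ _ → ⊥)

update : {A : Set} → (ℕ → A) → ℕ → A → (ℕ → A)
update m i v j = if j ≡ᵇ i then v else m j

putInt : Memory n → ℕ → ℤ → Memory n
putInt σ i v = mem (update (ints σ) i v) (sets σ)

putSet : Memory n → ℕ → Subset n → Memory n
putSet σ i X = mem (ints σ) (update (sets σ) i X)

address : Loc → Memory n → ℕ
address (at i)  σ = i
address (via i) σ = ∣ ints σ i ∣

-- The set {m} if m < n, and the empty set otherwise.
single : ℕ → Subset n
single {zero}  _       = []
single {suc n} zero    = inside ∷ ⊥
single {suc n} (suc m) = outside ∷ single m

has : Subset n → ℕ → Bool
has []      _       = false
has (s ∷ X) zero    = s
has (s ∷ X) (suc m) = has X m

intValue : IntExp → Memory n → ℤ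
intValue     (int z)     σ = z
intValue {n} groundSize  σ = + n
intValue     (get x)     σ = ints σ (address x σ)
intValue     (add a₁ a₂) σ = intValue a₁ σ ℤ.+ intValue a₂ σ
intValue     (sub a₁ a₂) σ = intValue a₁ σ ℤ.- intValue a₂ σ
intValue     (mul a₁ a₂) σ = intValue a₁ σ ℤ.* intValue a₂ σ

setValue : SetExp → Memory n → Subset n
setValue empty              σ = ⊥
setValue full               σ = ⊤
setValue (get x)            σ = sets σ (address x σ)
setValue (singleton a)      σ = single ∣ intValue a σ ∣
setValue (union e₁ e₂)      σ = setValue e₁ σ ∪ setValue e₂ σ
setValue (inter e₁ e₂)      σ = setValue e₁ σ ∩ setValue e₂ σ
setValue (difference e₁ e₂) σ = setValue e₁ σ ─ setValue e₂ σ

holds : Test → Memory n → Bool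
holds (leq a₁ a₂)    σ = intValue a₁ σ ℤ.≤ᵇ intValue a₂ σ
holds (contains x a) σ = has (sets σ (address x σ)) ∣ intValue a σ ∣

intTime : IntExp → ℕ
intTime (int z)     = 1
intTime groundSize  = 1
intTime (get x)     = 1
intTime (add a₁ a₂) = suc (intTime a₁ + intTime a₂)
intTime (sub a₁ a₂) = suc (intTime a₁ + intTime a₂)
intTime (mul a₁ a₂) = suc (intTime a₁ + intTime a₂)

setTime : ℕ → SetExp → ℕ
setTime n empty              = suc n
setTime n full               = suc n
setTime n (get x)            = suc n
setTime n (singleton a)      = suc n + intTime a
setTime n (union e₁ e₂)      = suc n + (setTime n e₁ + setTime n e₂)
setTime n (inter e₁ e₂)      = suc n + (setTime n e₁ + setTime n e₂)
setTime n (difference e₁ e₂) = suc n + (setTime n e₁ + setTime n e₂)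

testTime : Test → ℕ
testTime (leq a₁ a₂)    = suc (intTime a₁ + intTime a₂)
testTime (contains x a) = suc (intTime a)

------------------------------------------------------------------------
-- Execution

-- `queryTime` is the time of one query, on top of the time for
-- computing the queried set.
record EvaluationOracle (n : ℕ) : Set where
  constructor evalOracle
  field
    value     : Subset n → ℤ
    queryTime : ℕ

record FamilyOracle (n : ℕ) : Set where
  constructor familyOracle
  field
    family    : Family n
    queryTime : ℕ

MembershipOracle : Bool → ℕ → Set
MembershipOracle true  n = FamilyOracle n
MembershipOracle false n = Unit.⊤

private variable
  b              : Bool
  p p₁ p₂        : Program b
  σ σ′ σ₁ σ₂     : Memory n
  t t₁ t₂        : ℕ
  x              : Loc
  a              : IntExp
  e              : SetExp
  c              : Test
  X              : Subset n

redirect : EvaluationOracle n → Memory n → ℕ → SetExp → EvaluationOracle n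
redirect {n} (evalOracle f ω) σ q e =
  evalOracle (λ Z → f (setValue e (putSet σ q Z))) (setTime n e + ω)

mutual

  -- Run O M p σ σ′ t: started in σ, the program p halts in σ′ after time t.
  data Run {n : ℕ} (O : EvaluationOracle n) :
           {b : Bool} → MembershipOracle b n → Program b →
           Memory n → Memory n → ℕ → Set where

    skip     : {M : MembershipOracle b n} →
               Run O M skip σ σ 1

    setInt   : {M : MembershipOracle b n} →
               Run O M (setInt x a) σ
                   (putInt σ (address x σ) (intValue a σ)) (suc (intTime a))

    setSet   : {M : MembershipOracle b n} →
               Run O M (setSet x e) σ
                   (putSet σ (address x σ) (setValue e σ)) (suc (setTime n e))

    insert   : {M : MembershipOracle b n} →
               Run O M (insert x a) σ
                   (putSet σ (address x σ)
                     (sets σ (address x σ) ∪ single ∣ intValue a σ ∣))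
                   (suc (intTime a))

    delete   : {M : MembershipOracle b n} →
               Run O M (delete x a) σ
                   (putSet σ (address x σ)
                     (sets σ (address x σ) ─ single ∣ intValue a σ ∣))
                   (suc (intTime a))

    evaluate : {M : MembershipOracle b n} →
               Run O M (evaluate x e) σ
                   (putInt σ (address x σ)
                     (EvaluationOracle.value O (setValue e σ)))
                   (suc (setTime n e + EvaluationOracle.queryTime O))

    seq      : {M : MembershipOracle b n} →
               Run O M p₁ σ σ₁ t₁ → Run O M p₂ σ₁ σ₂ t₂ →
               Run O M (seq p₁ p₂) σ σ₂ (t₁ + t₂)

    ifTrue   : {M : MembershipOracle b n} →
               holds c σ ≡ true → Run O M p₁ σ σ′ t →
               Run O M (ifElse c p₁ p₂) σ σ′ (testTime c + t)

    ifFalse  : {M : MembershipOracle b n} →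
               holds c σ ≡ false → Run O M p₂ σ σ′ t →
               Run O M (ifElse c p₁ p₂) σ σ′ (testTime c + t)

    loop     : {M : MembershipOracle b n} →
               holds c σ ≡ true →
               Run O M p σ σ₁ t₁ → Run O M (while c p) σ₁ σ₂ t₂ →
               Run O M (while c p) σ σ₂ (testTime c + (t₁ + t₂))

    exit     : {M : MembershipOracle b n} →
               holds c σ ≡ false →
               Run O M (while c p) σ σ (testTime c)

    call     : {M : MembershipOracle b n} {A : Algorithm false} {q : ℕ} →
               Returns (redirect O σ q e) _ A X t →
               Run O M (call x A q e) σ
                   (putSet σ (address x σ) X) (suc t)

    member   : {M : FamilyOracle n} →
               Run O M (member x e) σ
                   (putInt σ (address x σ)
                     (if FamilyOracle.family M (setValue e σ) then 1ℤ else 0ℤ))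
                   (suc (setTime n e + FamilyOracle.queryTime M))

  -- Returns O M A X t: the algorithm A halts and returns X in total time
  -- t, which includes the time for writing the output.
  data Returns {n : ℕ} (O : EvaluationOracle n) :
               {b : Bool} → MembershipOracle b n → Algorithm b →
               Subset n → ℕ → Set where
    done : {M : MembershipOracle b n} →
           Run O M p initial σ t →
           Returns O M (p returning e) (setValue e σ) (t + setTime n e)

-- A minimizes every submodular function on every ground set of size n in
-- time at most τ n, where a query to the evaluation oracle takes one unit
-- of time once the queried set has been computed.
MinimizesSubmodularWithin : Algorithm false → (ℕ → ℕ) → Set
MinimizesSubmodularWithin A τ =
  ∀ n (f : Subset n → ℤ) → Submodular f →
  Σ[ X ∈ Subset n ] Σ[ t ∈ ℕ ]
    Returns (evalOracle f 1) _ A X t × IsMinimizer f powerset X × t ≤ τ n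

-- On the instance (f , 𝓕), with a query to the oracle for 𝓕 taking time γ,
-- B halts within time T and, unless 𝓕 is empty, returns a minimizer of f
-- over 𝓕.
MinimizesOverFamilyWithin :
  Algorithm true → (Subset n → ℤ) → Family n → (γ : ℕ) → ℕ → Set
MinimizesOverFamilyWithin {n} B f 𝓕 γ T =
  Σ[ X ∈ Subset n ] Σ[ t ∈ ℕ ]
    Returns (evalOracle f 1) (familyOracle 𝓕 γ) B X t
    × (Nonempty 𝓕 → IsMinimizer f 𝓕 X)
    × t ≤ T

{-# OPTIONS --safe #-}

-- Let Y ∈ 𝓕 and let chain 0 ⊆ … ⊆ chain k be the levels of the complement
-- of 𝓕.  If the interval [A , V ∖ B] around Y misses chain i, then its
-- intersection with chain (suc i) is closed under ∪ and ∩ and does not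
-- contain Y, so some pair s ∈ Y, t ∉ Y is separated by none of its members:
-- [A ∪ {s} , V ∖ (B ∪ {t})] misses chain (suc i).  After k such steps the
-- interval around Y lies in 𝓕, and minimizing the submodular function
-- Z ↦ f ((Z ∪ A) ∖ B) yields a member of 𝓕 that is at least as good as Y.
-- Hence it suffices to try all n ^ (2 * k) choices of k pairs.  The pairs
-- come from nested loops; for n ≥ 2 their overhead is a geometric series, so
-- that the constant does not depend on k.

module Submission where

open import Defs
open import Algebra.Core using (Op₂)
open import Data.Bool.Base using (Bool; true; false; T; if_then_else_)
open import Data.Bool.Properties using (T-≡; T?)
open import Data.Empty using (⊥-elim)
open import Data.Fin.Base using (Fin; toℕ) renaming (zero to fzero; suc to fsuc)
open import Data.Fin.Properties using (any?; toℕ<n)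
open import Data.Fin.Subset as Subset
  using (Subset; ⊤; ⊥; _∪_; _∩_; _─_; ∁; _∈_; _∉_; _⊆_; ⁅_⁆)
open import Data.Fin.Subset.Properties
open import Data.Integer.Base as ℤ using (ℤ; +_; 0ℤ; 1ℤ; ∣_∣)
import Data.Integer.Properties as ℤ
open import Data.List.Base as List using (List; allFin)
open import Data.List.Membership.Propositional.Properties using (∈-allFin)
open import Data.List.Relation.Unary.All as All using (All)
open import Data.Nat.Base
open import Data.Nat.Properties
open import Data.Nat.Tactic.RingSolver using (solve-∀)
open import Data.Product.Base using (Σ-syntax; ∃; ∃₂; _×_; _,_; proj₁; proj₂)
open import Data.Sum.Base using (_⊎_; inj₁; inj₂; [_,_]′)
open import Data.Vec.Base using ([]; _∷_; here; there)
open import Function.Base using (_∘_; id)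
open import Function.Bundles using (Equivalence)
open import Relation.Binary.PropositionalEquality
open import Relation.Nullary using (¬_; Dec; yes; no; contradiction)
open import Relation.Nullary.Decidable using (_×-dec_; ¬?; decidable-stable)

private variable
  n         : ℕ
  A B X Y Z : Subset n
  b         : Bool
  p         : Program b
  S         : Algorithm b
  σ σ′      : Memory n
  t         : ℕ

-- Isolating a member of 𝓕 by pairs of elements

module _ {P : Subset n → Set} {R : Fin n → Subset n → Set} (_⊙_ : Op₂ (Subset n))
  (closed    : ∀ {X Y} → P X → P Y → P (X ⊙ Y))
  (inherited : ∀ x {X Y} → R x X ⊎ R x Y → R x (X ⊙ Y))
  (local     : ∀ x → ∃ λ X → P X × R x X) where

  -- Folds `⊙` over the local witnesses: `P` survives by closure, and each `R x` passes on from
  -- either argument. The given element of `P` serves as the fold of the empty list.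
  gatherList : ∃ P → (xs : List (Fin n)) → ∃ λ X → P X × All (λ x → R x X) xs
  gatherList (X , pX) List.[]       = X , pX , All.[]
  gatherList p        (x List.∷ xs) with local x | gatherList p xs
  ... | Y , pY , r | X , pX , rs =
    X ⊙ Y , closed pX pY , inherited x (inj₂ r) All.∷ All.map (λ {y} → inherited y ∘ inj₁) rs

  gather : ∃ P → ∃ λ X → P X × (∀ x → R x X)
  gather p with gatherList p (allFin n)
  ... | X , pX , rs = X , pX , λ x → All.lookup rs (∈-allFin x)

-- If Z s t contains s and avoids t for all s ∈ Y and t ∉ Y, then the union
-- over s of ⋂ₜ Z s t is Y.
separated⇒member : {Q : Subset n → Set} →
  (∀ {X Y} → Q X → Q Y → Q (X ∪ Y)) → (∀ {X Y} → Q X → Q Y → Q (X ∩ Y)) →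
  Subset.Nonempty Y → Subset.Nonempty (∁ Y) →
  (∀ s t → s ∈ Y → t ∉ Y → ∃ λ Z → Q Z × s ∈ Z × t ∉ Z) → Q Y
separated⇒member {n = n} {Y = Y} {Q} ∪-closed ∩-closed (s₀ , s₀∈Y) (t₀ , t₀∈∁Y) separate
  with gather {P = λ W → Q W × W ⊆ Y} {R = λ s W → s ∈ Y → s ∈ W} _∪_
         (λ {V} {W} (qV , V⊆Y) (qW , W⊆Y) → ∪-closed qV qW , [ V⊆Y , W⊆Y ]′ ∘ x∈p∪q⁻ V W)
         (λ _ → λ { (inj₁ r) s∈Y → x∈p∪q⁺ (inj₁ (r s∈Y)) ; (inj₂ r) s∈Y → x∈p∪q⁺ (inj₂ (r s∈Y)) })
         outer (let W , qW , _ , W⊆Y = inner s₀ s₀∈Y in W , qW , λ {x} → W⊆Y x)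
  where
  inner : ∀ s → s ∈ Y → ∃ λ W → Q W × s ∈ W × (∀ t → t ∈ W → t ∈ Y)
  inner s s∈Y
    with gather {P = λ Z → Q Z × s ∈ Z} {R = λ t Z → t ∈ Z → t ∈ Y} _∩_
           (λ (qV , s∈V) (qW , s∈W) → ∩-closed qV qW , x∈p∩q⁺ (s∈V , s∈W))
           (λ _ {V} {W} → λ { (inj₁ r) → r ∘ proj₁ ∘ x∈p∩q⁻ V W ; (inj₂ r) → r ∘ proj₂ ∘ x∈p∩q⁻ V W })
           local (let Z , qZ , s∈Z , _ = separate s t₀ s∈Y (x∈∁p⇒x∉p t₀∈∁Y) in Z , qZ , s∈Z)
    where
    local : ∀ t → ∃ λ Z → (Q Z × s ∈ Z) × (t ∈ Z → t ∈ Y)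
    local t with t ∈? Y
    -- Here the demand on `t` is void, so any member of `Q` containing `s` will do; the one avoiding
    -- `t₀` is at hand.
    ... | yes t∈Y = let Z , qZ , s∈Z , _ = separate s t₀ s∈Y (x∈∁p⇒x∉p t₀∈∁Y)
                    in Z , (qZ , s∈Z) , λ _ → t∈Y
    ... | no t∉Y  = let Z , qZ , s∈Z , t∉Z = separate s t s∈Y t∉Y
                    in Z , (qZ , s∈Z) , λ t∈Z → contradiction t∈Z t∉Z
  ... | W , (qW , s∈W) , W⊆Y = W , qW , s∈W , W⊆Y
  outer : ∀ s → ∃ λ W → (Q W × W ⊆ Y) × (s ∈ Y → s ∈ W)
  outer s with s ∈? Y
  ... | yes s∈Y = let W , qW , s∈W , W⊆Y = inner s s∈Y in W , (qW , λ {x} → W⊆Y x) , λ _ → s∈W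
  ... | no s∉Y  = let W , qW , _ , W⊆Y = inner s₀ s₀∈Y
                  in W , (qW , λ {x} → W⊆Y x) , λ s∈Y → contradiction s∈Y s∉Y
... | W , (qW , W⊆Y) , Y⊆W = subst Q (⊆-antisym W⊆Y (λ {x} → Y⊆W x)) qW

full-set : {Y : Subset n} → Subset.Empty (∁ Y) → Y ≡ ⊤
full-set none = ⊆-antisym (⊆-max _) λ {x} _ → x∉∁p⇒x∈p λ x∈ → none (x , x∈)

fin≤1 : n ≤ 1 → (x y : Fin n) → x ≡ y
fin≤1 (s≤s z≤n) fzero fzero = refl

-- Intervals of subsets and the levels of the chain

Between : Subset n → Subset n → Subset n → Set
Between A B Z = A ⊆ Z × Z ⊆ ∁ B

between? : (A B Z : Subset n) → Dec (Between A B Z)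
between? A B Z = (A ⊆? Z) ×-dec (Z ⊆? ∁ B)

∪-between : Between A B X → Between A B Y → Between A B (X ∪ Y)
∪-between {X = X} {Y} (A⊆X , X⊆B) (A⊆Y , Y⊆B) = p⊆p∪q Y ∘ A⊆X , [ X⊆B , Y⊆B ]′ ∘ x∈p∪q⁻ X Y

∩-between : Between A B X → Between A B Y → Between A B (X ∩ Y)
∩-between {X = X} {Y} (A⊆X , X⊆B) (A⊆Y , Y⊆B) =
  (λ x∈A → x∈p∩q⁺ (A⊆X x∈A , A⊆Y x∈A)) , X⊆B ∘ proj₁ ∘ x∈p∩q⁻ X Y

single-toℕ : (x : Fin n) → single (toℕ x) ≡ ⁅ x ⁆
single-toℕ fzero    = refl
single-toℕ (fsuc x) = cong (_ ∷_) (single-toℕ x)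

∪-single-⊆ : {s : Fin n} → A ⊆ Z → s ∈ Z → A ∪ single (toℕ s) ⊆ Z
∪-single-⊆ {A = A} {Z} {s} A⊆Z s∈Z rewrite single-toℕ s =
  [ A⊆Z , (λ x∈s → subst (_∈ Z) (sym (x∈⁅y⁆⇒x≡y s x∈s)) s∈Z) ]′ ∘ x∈p∪q⁻ A ⁅ s ⁆

∈-∪-single : (A : Subset n) (s : Fin n) → s ∈ A ∪ single (toℕ s)
∈-∪-single A s rewrite single-toℕ s = q⊆p∪q A ⁅ s ⁆ (x∈⁅x⁆ s)

-- Exchanges included and excluded elements, so that facts about enlarging `A` apply to `B` with `Z`
-- complemented.
⊆-∁-swap : A ⊆ ∁ B → B ⊆ ∁ A
⊆-∁-swap A⊆∁B x∈B = x∉p⇒x∈∁p (λ x∈A → x∈∁p⇒x∉p (A⊆∁B x∈A) x∈B)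

between-extend : {s t : Fin n} → Between A B Z → s ∈ Z → t ∉ Z →
  Between (A ∪ single (toℕ s)) (B ∪ single (toℕ t)) Z
between-extend (A⊆Z , Z⊆∁B) s∈Z t∉Z =
  ∪-single-⊆ A⊆Z s∈Z , ⊆-∁-swap (∪-single-⊆ (⊆-∁-swap Z⊆∁B) (x∉p⇒x∈∁p t∉Z))

between-restrict : (s t : Fin n) →
  Between (A ∪ single (toℕ s)) (B ∪ single (toℕ t)) Z → Between A B Z × s ∈ Z × t ∉ Z
between-restrict {A = A} {B} s t (A⊆Z , Z⊆∁B) =
  (A⊆Z ∘ p⊆p∪q _ , ⊆-∁-swap (⊆-∁-swap Z⊆∁B ∘ p⊆p∪q _)) ,
  A⊆Z (∈-∪-single A s) , x∈∁p⇒x∉p (⊆-∁-swap Z⊆∁B (∈-∪-single B t))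

-- The recursion follows the loops of `search`, one pair per level. That each `s` lies in `Y` and
-- each `t` outside it is implied by the final `Between`.
Isolated : Family n → ℕ → Subset n → Subset n → Subset n → Set
Isolated 𝓕 zero    A B Y = Between A B Y × (∀ Z → Between A B Z → Z ∈ᶠ 𝓕)
Isolated {n} 𝓕 (suc d) A B Y =
  ∃₂ λ (s t : Fin n) → Isolated 𝓕 d (A ∪ single (toℕ s)) (B ∪ single (toℕ t)) Y

∈-∖ : (𝓖 𝓗 : Family n) → X ∈ᶠ 𝓖 → ¬ X ∈ᶠ 𝓗 → X ∈ᶠ 𝓖 ∖ 𝓗
∈-∖ {X = X} 𝓖 𝓗 p q with 𝓖 X | 𝓗 X
... | true | true  = q _
... | true | false = _

∖⇒∈ : (𝓖 𝓗 : Family n) → X ∈ᶠ 𝓖 ∖ 𝓗 → X ∈ᶠ 𝓖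
∖⇒∈ {X = X} 𝓖 𝓗 p with 𝓖 X
... | true = _

∖⇒∉ : (𝓖 𝓗 : Family n) → X ∈ᶠ 𝓖 ∖ 𝓗 → ¬ X ∈ᶠ 𝓗
∖⇒∉ {X = X} 𝓖 𝓗 p q with 𝓖 X | 𝓗 X
∖⇒∉ 𝓖 𝓗 () q | true | true

Separates : Family n → Subset n → Subset n → Fin n → Fin n → Subset n → Set
Separates 𝓖 A B s t Z = (Between A B Z × Z ∈ᶠ 𝓖) × s ∈ Z × t ∉ Z

-- Exhaustive search over all subsets. It serves the constructive case distinction in `isolate` and
-- is no part of the algorithm.
separates? : (𝓖 : Family n) (A B : Subset n) (s t : Fin n) → Dec (∃ (Separates 𝓖 A B s t))
separates? 𝓖 A B s t = anySubset? λ Z →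
  (between? A B Z ×-dec T? (𝓖 Z)) ×-dec ((s ∈? Z) ×-dec ¬? (t ∈? Z))

module _ {k : ℕ} {𝓕 : Family n} (complement : IsComplementOfHierarchicalLattice k 𝓕) where
  open HierarchicalLattice complement

  chain⊆chain : ∀ d {i} → d + i ≤ k → chain i ⊆ᶠ chain (d + i)
  chain⊆chain zero    _   X p = p
  chain⊆chain (suc d) d+i≤k X p = increases _ d+i≤k X (chain⊆chain d (≤-trans (n≤1+n _) d+i≤k) X p)

  chain∌ : ∀ d {i} → d + i ≡ k → Y ∈ᶠ 𝓕 → ¬ Y ∈ᶠ chain i
  chain∌ {Y = Y} d refl Y∈𝓕 p =
    ∖⇒∉ powerset 𝓕 (proj₁ top Y (chain⊆chain d ≤-refl Y p)) Y∈𝓕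

  -- Unions and intersections stay in the interval, which misses `chain i`, so only the first
  -- alternative of `uncross` can occur. The members of `chain (suc i)` in the interval thus form a
  -- lattice, and `separated⇒member` applies.
  unseparated⇒member : ∀ {i} → i < k → (∀ Z → Between A B Z → ¬ Z ∈ᶠ chain i) →
    Subset.Nonempty Y → Subset.Nonempty (∁ Y) →
    (∀ s t → s ∈ Y → t ∉ Y → ∃ (Separates (chain (suc i)) A B s t)) → Y ∈ᶠ chain (suc i)
  unseparated⇒member {A = A} {B} {i = i} i<k missed Y≢∅ Y≢V separate =
    proj₂ (separated⇒member {Q = Q}
      (λ p q → ∪-between (proj₁ p) (proj₁ q) , proj₁ (closed p q))
      (λ p q → ∩-between (proj₁ p) (proj₁ q) , proj₂ (closed p q))
      Y≢∅ Y≢V separate)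
    where
    Q : Subset _ → Set
    Q Z = Between A B Z × Z ∈ᶠ chain (suc i)
    level : ∀ {Z} → Q Z → Z ∈ᶠ chain (suc i) ∖ chain i
    level (b , p) = ∈-∖ (chain (suc i)) (chain i) p (missed _ b)
    closed : ∀ {X Z} → Q X → Q Z → X ∪ Z ∈ᶠ chain (suc i) × X ∩ Z ∈ᶠ chain (suc i)
    closed {X} {Z} p q with uncross i i<k X Z (level p) (level q)
    ... | inj₁ (u , v)  = ∖⇒∈ (chain (suc i)) (chain i) u , ∖⇒∈ (chain (suc i)) (chain i) v
    ... | inj₂ (inj₁ u) = contradiction u (missed _ (∪-between (proj₁ p) (proj₁ q)))
    ... | inj₂ (inj₂ v) = contradiction v (missed _ (∩-between (proj₁ p) (proj₁ q)))

  isolate : Y ∈ᶠ 𝓕 → Subset.Nonempty Y → Subset.Nonempty (∁ Y) →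
    ∀ d i → d + i ≡ k → Between A B Y → (∀ Z → Between A B Z → ¬ Z ∈ᶠ chain i) →
    Isolated 𝓕 d A B Y
  -- Now `i` is `k`, and a set outside `𝓕` would belong to `chain k`.
  isolate Y∈𝓕 _ _ zero i refl AYB missed = AYB , λ Z AZB → decidable-stable (T? (𝓕 Z))
    λ Z∉𝓕 → missed Z AZB (proj₂ top Z (∈-∖ powerset 𝓕 _ Z∉𝓕))
  isolate {Y = Y} {A} {B} Y∈𝓕 Y≢∅ Y≢V (suc d) i refl AYB missed
    with any? (λ s → any? (λ t →
           (s ∈? Y) ×-dec (¬? (t ∈? Y) ×-dec ¬? (separates? (chain (suc i)) A B s t))))
  ... | yes (s , t , s∈Y , t∉Y , none) =
    s , t , isolate Y∈𝓕 Y≢∅ Y≢V d (suc i) (+-suc d i) (between-extend AYB s∈Y t∉Y)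
      -- A member of `chain (suc i)` in the smaller interval would be one in the larger interval
      -- that separates `s` from `t`.
      λ Z b Z∈ → let AZB , s∈Z , t∉Z = between-restrict s t b in none (Z , (AZB , Z∈) , s∈Z , t∉Z)
  ... | no noCut = ⊥-elim (chain∌ d (+-suc d i) Y∈𝓕
    (unseparated⇒member (≤-trans (m≤n+m (suc i) d) (≤-reflexive (+-suc d i))) missed Y≢∅ Y≢V
      λ s t s∈Y t∉Y → decidable-stable (separates? (chain (suc i)) A B s t)
        λ none → noCut (s , t , s∈Y , t∉Y , none)))

-- Minimization over an interval

-- For disjoint `A` and `B` this is the retraction of the powerset onto the interval, so minimizing
-- over the interval becomes minimizing over all subsets.
clamp : Subset n → Subset n → Subset n → Subset n
clamp A B Z = (Z ∪ A) ─ B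

clamp-∪ : (A B X Y : Subset n) → clamp A B (X ∪ Y) ≡ clamp A B X ∪ clamp A B Y
clamp-∪ []          []          []          []          = refl
clamp-∪ (a ∷ A)     (true ∷ B)  (x ∷ X)     (y ∷ Y)     = cong (_ ∷_) (clamp-∪ A B X Y)
clamp-∪ (true ∷ A)  (false ∷ B) (true ∷ X)  (y ∷ Y)     = cong (_ ∷_) (clamp-∪ A B X Y)
clamp-∪ (true ∷ A)  (false ∷ B) (false ∷ X) (true ∷ Y)  = cong (_ ∷_) (clamp-∪ A B X Y)
clamp-∪ (true ∷ A)  (false ∷ B) (false ∷ X) (false ∷ Y) = cong (_ ∷_) (clamp-∪ A B X Y)
clamp-∪ (false ∷ A) (false ∷ B) (true ∷ X)  (y ∷ Y)     = cong (_ ∷_) (clamp-∪ A B X Y)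
clamp-∪ (false ∷ A) (false ∷ B) (false ∷ X) (y ∷ Y)     = cong (_ ∷_) (clamp-∪ A B X Y)

clamp-∩ : (A B X Y : Subset n) → clamp A B (X ∩ Y) ≡ clamp A B X ∩ clamp A B Y
clamp-∩ []          []          []          []          = refl
clamp-∩ (a ∷ A)     (true ∷ B)  (x ∷ X)     (y ∷ Y)     = cong (_ ∷_) (clamp-∩ A B X Y)
clamp-∩ (a ∷ A)     (false ∷ B) (true ∷ X)  (true ∷ Y)  = cong (_ ∷_) (clamp-∩ A B X Y)
clamp-∩ (true ∷ A)  (false ∷ B) (true ∷ X)  (false ∷ Y) = cong (_ ∷_) (clamp-∩ A B X Y)
clamp-∩ (false ∷ A) (false ∷ B) (true ∷ X)  (false ∷ Y) = cong (_ ∷_) (clamp-∩ A B X Y)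
clamp-∩ (true ∷ A)  (false ∷ B) (false ∷ X) (true ∷ Y)  = cong (_ ∷_) (clamp-∩ A B X Y)
clamp-∩ (true ∷ A)  (false ∷ B) (false ∷ X) (false ∷ Y) = cong (_ ∷_) (clamp-∩ A B X Y)
clamp-∩ (false ∷ A) (false ∷ B) (false ∷ X) (y ∷ Y)     = cong (_ ∷_) (clamp-∩ A B X Y)

-- `clamp A B` is a lattice homomorphism even if `A` and `B` overlap. Hence the subroutine can be
-- called for every choice of pairs, including contradictory ones.
clamp-submodular : (f : Subset n → ℤ) (A B : Subset n) → Submodular f → Submodular (f ∘ clamp A B)
clamp-submodular f A B f-sub X Y rewrite clamp-∪ A B X Y | clamp-∩ A B X Y = f-sub _ _

x∈p─q⇒x∉q : (X Y : Subset n) → ∀ {x} → x ∈ X ─ Y → x ∉ Y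
x∈p─q⇒x∉q (_ ∷ X) (_ ∷ Y) (there x∈) (there x∈Y) = x∈p─q⇒x∉q X Y x∈ x∈Y
x∈p─q⇒x∉q (_ ∷ X) (true ∷ Y) () here

clamp-between : (Z : Subset n) → A ⊆ ∁ B → Between A B (clamp A B Z)
clamp-between {A = A} {B} Z A⊆∁B =
  (λ x∈A → x∈p∧x∉q⇒x∈p─q (q⊆p∪q Z A x∈A) (x∈∁p⇒x∉p (A⊆∁B x∈A))) ,
  (λ x∈ → x∉p⇒x∈∁p (x∈p─q⇒x∉q (Z ∪ A) B x∈))

between⇒clamp≡ : Between A B Y → clamp A B Y ≡ Y
between⇒clamp≡ {A = A} {B} {Y} (A⊆Y , Y⊆∁B) = ⊆-antisym
  ([ id , A⊆Y ]′ ∘ x∈p∪q⁻ Y A ∘ p─q⊆p (Y ∪ A) B)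
  (λ x∈Y → x∈p∧x∉q⇒x∈p─q (p⊆p∪q A x∈Y) (x∈∁p⇒x∉p (Y⊆∁B x∈Y)))

-- Running times under slower evaluation queries

n<setTime : ∀ n e → n < setTime n e
n<setTime n empty              = ≤-refl
n<setTime n full               = ≤-refl
n<setTime n (get x)            = ≤-refl
n<setTime n (singleton a)      = m≤m+n (suc n) _
n<setTime n (union e₁ e₂)      = m≤m+n (suc n) _
n<setTime n (inter e₁ e₂)      = m≤m+n (suc n) _
n<setTime n (difference e₁ e₂) = m≤m+n (suc n) _

run-positive : {O : EvaluationOracle n} {M : MembershipOracle b n} → Run O M p σ σ′ t → 0 < t
run-positive skip         = z<s
run-positive setInt       = z<s
run-positive setSet       = z<s
run-positive insert       = z<s
run-positive delete       = z<s
run-positive evaluate     = z<s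
run-positive (seq r _)    = ≤-trans (run-positive r) (m≤m+n _ _)
run-positive (ifTrue {c = c} _ r)  = ≤-trans (run-positive r) (m≤n+m _ (testTime c))
run-positive (ifFalse {c = c} _ r) = ≤-trans (run-positive r) (m≤n+m _ (testTime c))
run-positive (loop {c = c} _ r _)  = ≤-trans (run-positive r) (≤-trans (m≤m+n _ _) (m≤n+m _ (testTime c)))
run-positive (exit {c = leq _ _} _)      = z<s
run-positive (exit {c = contains _ _} _) = z<s
run-positive (call _)     = z<s
run-positive member       = z<s

returns-time : {O : EvaluationOracle n} {M : MembershipOracle b n} → Returns O M S X t → suc n < t
returns-time {n = n} (done {e = e} r) = +-mono-≤ (run-positive r) (n<setTime n e)

-- A query costs at least suc n, the time for computing the queried set, so
-- queries that are slower by D * suc n multiply the running time by at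
-- most suc D.
module _ (D : ℕ) where

  private
    scale : ∀ {a b c d} → a ≤ suc D * c → b ≤ suc D * d → a + b ≤ suc D * (c + d)
    scale {c = c} {d} p q = ≤-trans (+-mono-≤ p q) (≤-reflexive (sym (*-distribˡ-+ (suc D) c d)))

    keep : ∀ {a} → a ≤ suc D * a
    keep = m≤m+n _ _

    query : ∀ {n ω ω′} e → ω′ ≤ ω + D * suc n → suc (setTime n e + ω′) ≤ suc D * suc (setTime n e + ω)
    query {n} {ω} {ω′} e slow = s≤s (begin
      setTime n e + ω′                       ≤⟨ +-monoʳ-≤ (setTime n e) slow ⟩
      setTime n e + (ω + D * suc n)          ≡⟨ +-assoc (setTime n e) ω _ ⟨
      setTime n e + ω + D * suc n            ≤⟨ +-monoʳ-≤ (setTime n e + ω) (*-monoʳ-≤ D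
                                                  (m≤n⇒m≤1+n (≤-trans (n<setTime n e) (m≤m+n _ ω)))) ⟩
      setTime n e + ω + D * suc (setTime n e + ω) ∎)
      where open ≤-Reasoning

  run-slowdown : {f : Subset n → ℤ} {ω ω′ : ℕ} {M : MembershipOracle b n} → ω′ ≤ ω + D * suc n →
    Run (evalOracle f ω) M p σ σ′ t → ∃ λ t′ → Run (evalOracle f ω′) M p σ σ′ t′ × t′ ≤ suc D * t
  returns-slowdown : {f : Subset n → ℤ} {ω ω′ : ℕ} {M : MembershipOracle b n} → ω′ ≤ ω + D * suc n →
    Returns (evalOracle f ω) M S X t → ∃ λ t′ → Returns (evalOracle f ω′) M S X t′ × t′ ≤ suc D * t

  run-slowdown slow skip     = _ , skip , keep
  run-slowdown slow setInt   = _ , setInt , keep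
  run-slowdown slow setSet   = _ , setSet , keep
  run-slowdown slow insert   = _ , insert , keep
  run-slowdown slow delete   = _ , delete , keep
  run-slowdown slow (evaluate {e = e}) = _ , evaluate , query e slow
  run-slowdown slow (seq r₁ r₂) with run-slowdown slow r₁ | run-slowdown slow r₂
  ... | _ , s₁ , u₁ | _ , s₂ , u₂ = _ , seq s₁ s₂ , scale u₁ u₂
  run-slowdown slow (ifTrue {c = c} h r) with run-slowdown slow r
  ... | _ , s , u = _ , ifTrue h s , scale (keep {testTime c}) u
  run-slowdown slow (ifFalse {c = c} h r) with run-slowdown slow r
  ... | _ , s , u = _ , ifFalse h s , scale (keep {testTime c}) u
  run-slowdown slow (loop {c = c} h r₁ r₂) with run-slowdown slow r₁ | run-slowdown slow r₂
  ... | _ , s₁ , u₁ | _ , s₂ , u₂ = _ , loop h s₁ s₂ , scale (keep {testTime c}) (scale u₁ u₂)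
  run-slowdown slow (exit h) = _ , exit h , keep
  -- The query time inside the call is `setTime n e` plus that of the caller, so the slowdown is
  -- again at most `D * suc n` and the induction goes on with the same `D`.
  run-slowdown {n = n} {ω = ω} slow (call {e = e} r)
    with returns-slowdown (≤-trans (+-monoʳ-≤ (setTime n e) slow)
                                   (≤-reflexive (sym (+-assoc (setTime n e) ω (D * suc n))))) r
  ... | _ , s , u = _ , call s , scale {1} {c = 1} (keep {1}) u
  run-slowdown slow member = _ , member , keep

  returns-slowdown {n = n} slow (done {e = e} r) with run-slowdown slow r
  ... | _ , s , u = _ , done s , scale u (keep {setTime n e})

-- The algorithm

update-same : {A : Set} (m : ℕ → A) (i : ℕ) (v : A) → update m i v i ≡ v
update-same m i v rewrite Equivalence.to T-≡ (≡⇒≡ᵇ i i refl) = refl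

update-other : {A : Set} (m : ℕ → A) {i j : ℕ} (v : A) → j ≢ i → update m i v j ≡ m j
update-other m {i} {j} v j≢i with j ≡ᵇ i in eq
... | false = refl
... | true  = contradiction (≡ᵇ⇒≡ j i (Equivalence.from T-≡ eq)) j≢i

≤ᵇ-true : ∀ {x y} → x ℤ.≤ y → (x ℤ.≤ᵇ y) ≡ true
≤ᵇ-true = Equivalence.to T-≡ ∘ ℤ.≤⇒≤ᵇ

≤ᵇ-true⁻ : ∀ {x y} → (x ℤ.≤ᵇ y) ≡ true → x ℤ.≤ y
≤ᵇ-true⁻ = ℤ.≤ᵇ⇒≤ ∘ Equivalence.from T-≡

≤ᵇ-false : ∀ {x y} → ¬ x ℤ.≤ y → (x ℤ.≤ᵇ y) ≡ false
≤ᵇ-false {x} {y} x≰y with x ℤ.≤ᵇ y in eq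
... | false = refl
... | true  = contradiction (≤ᵇ-true⁻ eq) x≰y

≤ᵇ-false⁻ : ∀ {x y} → (x ℤ.≤ᵇ y) ≡ false → y ℤ.≤ x
≤ᵇ-false⁻ {x} {y} eq with x ℤ.≤? y
... | yes x≤y = contradiction (trans (sym eq) (≤ᵇ-true x≤y)) λ ()
... | no x≰y  = ℤ.<⇒≤ (ℤ.≰⇒> x≰y)

flag : ∀ b → (1ℤ ℤ.≤ᵇ (if b then 1ℤ else 0ℤ)) ≡ b
flag true  = refl
flag false = refl

-- Set cell 0 holds the best set so far, set cell 1 the current candidate.
keepCandidate examine : Program true
keepCandidate = setSet (at 0) (get (at 1))
examine =
  seq (member (at 0) (get (at 1)))
  (ifElse (leq (int 1ℤ) (get (at 0)))
    -- The best set is tested too: it starts as the empty set, which may lie outside `𝓕` and must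
    -- then give way to any candidate in `𝓕`.
    (seq (member (at 0) (get (at 0)))
    (ifElse (leq (int 1ℤ) (get (at 0)))
      (seq (evaluate (at 1) (get (at 0)))
      (seq (evaluate (at 2) (get (at 1)))
      (ifElse (leq (get (at 1)) (get (at 2))) skip keepCandidate)))
      keepCandidate))
    skip)

for : ℕ → Program true → Program true
for i p =
  seq (setInt (at i) (int 0ℤ))
  -- The test `counter < n`, expressed by `leq`.
  (while (leq (add (get (at i)) (int 1ℤ)) groundSize)
    (seq p (setInt (at i) (add (get (at i)) (int 1ℤ)))))

-- With d pairs left to be chosen, the sets A and B chosen so far are held
-- by the cells base d and suc (base d).
base : ℕ → ℕ
base d = d * 2 + 3

clampExp : SetExp
clampExp = difference (union (get (at 1)) (get (at (base 0)))) (get (at (suc (base 0))))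

search : Algorithm false → ℕ → Program true
search S zero =
  -- Each queried set is placed in cell 1, so `S` minimizes `f` composed with `clamp`. The set it
  -- returns need not lie in the interval; only its clamped version does.
  seq (call (at 1) S 1 clampExp)
  (seq (setSet (at 1) clampExp) examine)
search S (suc d) =
  -- The loop counters are the integer cells with the numbers of the two set cells: the outer one
  -- chooses `s`, the inner one `t`. The offset 3 in `base` keeps them clear of the cells used by
  -- `examine`.
  for (suc (base d)) (for (base d)
    (seq (setSet (at (base d)) (union (get (at (base (suc d)))) (singleton (get (at (suc (base d)))))))
    (seq (setSet (at (suc (base d))) (union (get (at (suc (base (suc d))))) (singleton (get (at (base d))))))
    (search S d))))

-- ∅ needs no examination: it is the initial value of the best set.  The loops
-- are skipped for n = 1, where the time bound does not grow with k.
searchAll : Algorithm false → ℕ → Algorithm true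
searchAll S k =
  seq (setSet (at 1) full)
  (seq examine
  (ifElse (leq (int (+ 2)) groundSize) (search S k) skip))
  returning get (at 0)

examineTime : ℕ → ℕ → ℕ
examineTime n γ =
  let m = suc (suc n + γ) ; e = suc (suc n + 1) in
  m + (3 + (m + (3 + (e + (e + (3 + suc (suc n)))))))

-- Evaluating the five nodes of `clampExp` slows each query by `5 * suc n`, whence the factor 6.
leafTime : ℕ → ℕ → ℕ → ℕ
leafTime n γ τ = suc (6 * τ) + (suc (setTime n clampExp) + examineTime n γ)

extendTime : ℕ → ℕ
extendTime n = suc (suc n + (suc n + (suc n + 1)))

-- Initialization takes 2, each test 5 and each increment 4; the last summand is the failing test.
forTime : ℕ → ℕ → ℕ
forTime n u = 2 + (n * (u + 9) + 5)

searchTime : ℕ → ℕ → ℕ → ℕ → ℕ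
searchTime n γ τ zero    = leafTime n γ τ
searchTime n γ τ (suc d) =
  forTime n (forTime n (extendTime n + (extendTime n + searchTime n γ τ d)))

-- Correctness and running time of the search

module _ {n : ℕ} (f : Subset n → ℤ) (𝓕 : Family n) (γ : ℕ) where

  private
    O : EvaluationOracle n
    O = evalOracle f 1
    M : FamilyOracle n
    M = familyOracle 𝓕 γ

  -- Correctness is tracked for one competitor `Y` at a time; a set covering every member of a
  -- nonempty `𝓕` is a minimizer.
  Covers : Subset n → Subset n → Set
  Covers X Y = X ∈ᶠ 𝓕 × f X ℤ.≤ f Y

  -- A frame condition: the counters and the sets `A`, `B` of the enclosing loops must survive the
  -- inner program, and whatever has been covered once must stay covered.
  record Progress (i j : ℕ) (σ σ′ : Memory n) : Set where
    constructor progress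
    field
      keepsInts : ∀ {l} → i ≤ l → ints σ′ l ≡ ints σ l
      keepsSets : ∀ {l} → j ≤ l → sets σ′ l ≡ sets σ l
      keepsBest : ∀ Y → Covers (sets σ 0) Y → Covers (sets σ′ 0) Y
  open Progress

  Improves : ℕ → ℕ → Program true → Memory n → (Subset n → Set) → ℕ → Set
  Improves i j p σ G T = ∃₂ λ σ′ t →
    Run O M p σ σ′ t × Progress i j σ σ′ × (∀ Y → G Y → Covers (sets σ′ 0) Y) × t ≤ T

  progress-trans : ∀ {i j σ₁ σ₂ σ₃} → Progress i j σ₁ σ₂ → Progress i j σ₂ σ₃ → Progress i j σ₁ σ₃
  progress-trans p q = progress
    (λ l → trans (keepsInts q l) (keepsInts p l))
    (λ l → trans (keepsSets q l) (keepsSets p l))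
    (λ Y → keepsBest q Y ∘ keepsBest p Y)

  progress-weaken : ∀ {i i′ j j′ σ σ′} → i ≤ i′ → j ≤ j′ → Progress i j σ σ′ → Progress i′ j′ σ σ′
  progress-weaken i≤ j≤ p = progress (keepsInts p ∘ ≤-trans i≤) (keepsSets p ∘ ≤-trans j≤) (keepsBest p)

  progress-refl : ∀ {i j σ} → Progress i j σ σ
  progress-refl = progress (λ _ → refl) (λ _ → refl) (λ _ c → c)

  progress-putInt : ∀ {i j l σ v} → l < i → Progress i j σ (putInt σ l v)
  progress-putInt {σ = σ} l<i = progress
    (λ i≤ → update-other (ints σ) _ (≢-sym (<⇒≢ (<-≤-trans l<i i≤)))) (λ _ → refl) (λ _ c → c)

  progress-putSet : ∀ {i j l σ X} → 0 < l → l < j → Progress i j σ (putSet σ l X)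
  progress-putSet {l = suc _} {σ} _ l<j = progress
    (λ _ → refl) (λ j≤ → update-other (sets σ) _ (≢-sym (<⇒≢ (<-≤-trans l<j j≤)))) (λ _ c → c)

  examine-improves : ∀ σ → Improves 3 1 examine σ (Covers (sets σ 1)) (examineTime n γ)
  examine-improves σ with 𝓕 (sets σ 1) in cand
  ... | false = _ , _ , seq member (ifFalse (trans (flag _) cand) skip) ,
    progress-putInt (s≤s z≤n) ,
    (λ Y ()) ,
    +-monoʳ-≤ (suc (suc n + γ)) (+-monoʳ-≤ 3 (s≤s z≤n))
  ... | true with 𝓕 (sets σ 0) in best
  ...   | false = _ , _ ,
    seq member (ifTrue (trans (flag _) cand) (seq member (ifFalse (trans (flag _) best) setSet))) ,
    -- The old best set lies outside `𝓕`, so it covers nothing that could be lost.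
    progress (λ { (s≤s _) → refl }) (λ { (s≤s _) → refl }) (λ Y c → ⊥-elim (subst T best (proj₁ c))) ,
    (λ Y c → subst T (sym cand) _ , proj₂ c) ,
    +-monoʳ-≤ (suc (suc n + γ)) (+-monoʳ-≤ 3 (+-monoʳ-≤ (suc (suc n + γ)) (+-monoʳ-≤ 3
      (≤-trans (m≤n+m _ (suc (suc n + 1) + (suc (suc n + 1) + 3)))
               (≤-reflexive (shuffle (suc (suc n + 1)) (suc (suc n))))))))
    where
    shuffle : ∀ e r → e + (e + 3) + r ≡ e + (e + (3 + r))
    shuffle = solve-∀
  ...   | true with f (sets σ 0) ℤ.≤ᵇ f (sets σ 1) in cmp
  ...     | true = _ , _ ,
    seq member (ifTrue (trans (flag _) cand) (seq member (ifTrue (trans (flag _) best)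
      (seq evaluate (seq evaluate (ifTrue cmp skip)))))) ,
    progress (λ { (s≤s (s≤s (s≤s _))) → refl }) (λ _ → refl) (λ Y c → c) ,
    (λ Y c → subst T (sym best) _ , ℤ.≤-trans (≤ᵇ-true⁻ cmp) (proj₂ c)) ,
    +-monoʳ-≤ (suc (suc n + γ)) (+-monoʳ-≤ 3 (+-monoʳ-≤ (suc (suc n + γ)) (+-monoʳ-≤ 3
      (+-monoʳ-≤ (suc (suc n + 1)) (+-monoʳ-≤ (suc (suc n + 1)) (+-monoʳ-≤ 3 (s≤s z≤n)))))))
  ...     | false = _ , _ ,
    seq member (ifTrue (trans (flag _) cand) (seq member (ifTrue (trans (flag _) best)
      (seq evaluate (seq evaluate (ifFalse cmp setSet)))))) ,
    progress (λ { (s≤s (s≤s (s≤s _))) → refl }) (λ { (s≤s _) → refl })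
      (λ Y c → subst T (sym cand) _ , ℤ.≤-trans (≤ᵇ-false⁻ cmp) (proj₂ c)) ,
    (λ Y c → subst T (sym cand) _ , proj₂ c) ,
    ≤-refl

  module _ {i j u : ℕ} {p : Program true} {G : ℕ → Subset n → Set} {σ : Memory n}
    (body : ∀ m → m < n → ∀ σ₁ → Progress (suc i) j σ σ₁ → ints σ₁ i ≡ + m →
            Improves i j p σ₁ (G m) u) where

    -- Induction on the number `r` of remaining rounds. The body writes only integer cells below
    -- `i`, so the counter survives it; the loop itself changes cell `i`, hence the bound `suc i`.
    -- Progress since `σ` is carried along because the body relies on cells set before the loop.
    while-improves : ∀ r m σ₁ → m + r ≡ n → Progress (suc i) j σ σ₁ → ints σ₁ i ≡ + m →
      Improves (suc i) j
        (while (leq (add (get (at i)) (int 1ℤ)) groundSize)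
               (seq p (setInt (at i) (add (get (at i)) (int 1ℤ)))))
        σ₁ (λ Y → ∃ λ l → m ≤ l × l < n × G l Y) (r * (u + 9) + 5)
    while-improves zero m σ₁ refl _ counter = _ , _ ,
      exit (trans (cong (λ z → (z ℤ.+ 1ℤ) ℤ.≤ᵇ + n) counter)
             (≤ᵇ-false {+ (m + 1)} {+ n} λ { (ℤ.+≤+ m+1≤n) →
               <⇒≱ (≤-reflexive (trans (cong suc (+-identityʳ m)) (+-comm 1 m))) m+1≤n })) ,
      progress-refl ,
      (λ { Y (l , m≤l , l<n , _) → contradiction (≤-trans l<n (≤-reflexive (+-identityʳ m))) (≤⇒≯ m≤l) }) ,
      ≤-refl
    while-improves (suc r) m σ₁ m+r≡n σ→σ₁ counter
      with body m m<n σ₁ σ→σ₁ counter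
      where
      m<n : m < n
      m<n = ≤-trans (m≤m+n (suc m) r) (≤-reflexive (trans (sym (+-suc m r)) m+r≡n))
    ... | σ₂ , t , run , σ₁→σ₂ , covers , t≤u
      with while-improves r (suc m) σ₃ (trans (sym (+-suc m r)) m+r≡n)
             (progress-trans σ→σ₁ σ₁→σ₃) counter′
      where
      σ₃ : Memory n
      σ₃ = putInt σ₂ i (ints σ₂ i ℤ.+ 1ℤ)
      σ₁→σ₃ : Progress (suc i) j σ₁ σ₃
      σ₁→σ₃ = progress-trans (progress-weaken (n≤1+n i) ≤-refl σ₁→σ₂) (progress-putInt ≤-refl)
      counter′ : ints σ₃ i ≡ + suc m
      counter′ = trans (update-same (ints σ₂) i _)
        (trans (cong (ℤ._+ 1ℤ) (trans (keepsInts σ₁→σ₂ ≤-refl) counter)) (cong +_ (+-comm m 1)))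
    ... | σ₄ , t′ , run′ , σ₃→σ₄ , covers′ , t′≤ = _ , _ ,
      loop (trans (cong (λ z → (z ℤ.+ 1ℤ) ℤ.≤ᵇ + n) counter) (≤ᵇ-true (ℤ.+≤+ m+1≤n))) (seq run setInt) run′ ,
      progress-trans (progress-weaken (n≤1+n i) ≤-refl σ₁→σ₂) (progress-trans (progress-putInt ≤-refl) σ₃→σ₄) ,
      (λ { Y (l , m≤l , l<n , g) → combined Y l l<n g (m≤n⇒m<n∨m≡n m≤l) }) ,
      ≤-trans (+-monoʳ-≤ 5 (+-mono-≤ (+-monoˡ-≤ 4 t≤u) t′≤)) (≤-reflexive (regroup u (r * (u + 9))))
      where
      m+1≤n : m + 1 ≤ n
      m+1≤n = ≤-trans (+-monoʳ-≤ m (s≤s z≤n)) (≤-reflexive m+r≡n)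
      combined : ∀ Y l → l < n → G l Y → _ → Covers (sets σ₄ 0) Y
      combined Y l l<n g (inj₁ m<l)  = covers′ Y (l , m<l , l<n , g)
      combined Y l l<n g (inj₂ refl) = keepsBest σ₃→σ₄ Y (covers Y g)
      regroup : ∀ u w → 5 + ((u + 4) + (w + 5)) ≡ (u + 9) + w + 5
      regroup = solve-∀

    for-improves : Improves (suc i) j (for i p) σ (λ Y → ∃ λ l → l < n × G l Y) (forTime n u)
    for-improves
      with while-improves n 0 (putInt σ i 0ℤ) refl (progress-putInt ≤-refl) (update-same (ints σ) i 0ℤ)
    ... | σ′ , t , run , σ→σ′ , covers , t≤ = _ , _ ,
      seq setInt run ,
      progress-trans (progress-putInt ≤-refl) σ→σ′ ,
      (λ { Y (l , l<n , g) → covers Y (l , z≤n , l<n , g) }) ,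
      +-monoʳ-≤ 2 t≤

  module _ (S : Algorithm false) (τ : ℕ → ℕ) (S-minimizes : MinimizesSubmodularWithin S τ)
    (f-submodular : Submodular f) where

    -- A halting run takes at least one step and then writes its output. This lower bound lets `τ n`
    -- absorb all overhead linear in `n`.
    n+2≤τ : 2 + n ≤ τ n
    n+2≤τ with S-minimizes n f f-submodular
    ... | _ , _ , returns , _ , t≤τ = ≤-trans (returns-time returns) t≤τ

    -- For an isolated `Y` the clamped minimizer lies in the interval, hence in `𝓕`, and its value
    -- is at most that of `clamp A B Y`, which is `Y`.
    leaf-improves : ∀ σ → Improves (base 0) (base 0) (search S 0) σ
      (Isolated 𝓕 0 (sets σ (base 0)) (sets σ (suc (base 0)))) (leafTime n γ (τ n))
    leaf-improves σ
      with S-minimizes n (f ∘ clamp (sets σ 3) (sets σ 4)) (clamp-submodular f (sets σ 3) (sets σ 4) f-submodular)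
    ... | X , t , returns , (_ , minimal) , t≤τ
      with returns-slowdown 5 (≤-reflexive (queryTime n)) returns
      where
      queryTime : ∀ n → suc n + ((suc n + (suc n + suc n)) + suc n) + 1 ≡ 1 + 5 * suc n
      queryTime = solve-∀
    ... | t′ , returns′ , t′≤
      with examine-improves (putSet (putSet σ 1 X) 1 (clamp (sets σ 3) (sets σ 4) X))
    ... | σ′ , t″ , run , σ→σ′ , covers , t″≤ = _ , _ ,
      seq (call returns′) (seq setSet run) ,
      progress-trans (progress-putSet {X = X} z<s (s≤s (s≤s z≤n)))
        (progress-trans (progress-putSet z<s (s≤s (s≤s z≤n))) (progress-weaken ≤-refl (s≤s z≤n) σ→σ′)) ,
      (λ Y (AYB , isolated) → covers Y
        ( isolated _ (clamp-between X (proj₂ AYB ∘ proj₁ AYB))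
        , subst (λ Z → _ ℤ.≤ f Z) (between⇒clamp≡ AYB) (minimal Y _))) ,
      +-mono-≤ (s≤s (≤-trans t′≤ (*-monoʳ-≤ 6 t≤τ))) (+-monoʳ-≤ (suc (setTime n clampExp)) t″≤)

    search-improves : ∀ d σ → Improves (base d) (base d) (search S d) σ
      (Isolated 𝓕 d (sets σ (base d)) (sets σ (suc (base d)))) (searchTime n γ (τ n) d)
    search-improves zero    σ = leaf-improves σ
    search-improves (suc d) σ =
      let σ′ , t , run , σ→σ′ , covers , t≤ = for-improves {G = Gₛ} outer
      in σ′ , t , run , σ→σ′ ,
         (λ { Y (x , y , g) → covers Y (toℕ x , toℕ<n x , toℕ y , toℕ<n y , g) }) , t≤
      where
      A₀ = sets σ (base (suc d))
      B₀ = sets σ (suc (base (suc d)))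

      G : ℕ → ℕ → Subset n → Set
      G s t = Isolated 𝓕 d (A₀ ∪ single s) (B₀ ∪ single t)

      Gₛ : ℕ → Subset n → Set
      Gₛ s Y = ∃ λ t → t < n × G s t Y

      0<base : 0 < base d
      0<base = ≤-trans (s≤s z≤n) (m≤n+m 3 (d * 2))

      -- `2 + base d` computes to `base (suc d)`, so `A₀` and `B₀` survive all rounds of both loops,
      -- while the two set cells below are overwritten in each round.
      inner : ∀ s σ₁ → Progress (2 + base d) (2 + base d) σ σ₁ → ints σ₁ (suc (base d)) ≡ + s →
        ∀ t → t < n → ∀ σ₂ → Progress (suc (base d)) (2 + base d) σ₁ σ₂ → ints σ₂ (base d) ≡ + t →
        Improves (base d) (2 + base d) _ σ₂ (G s t) _
      inner s σ₁ σ→σ₁ counterₛ t t<n σ₂ σ₁→σ₂ counterₜ =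
        let σ₅ , u , run , σ₄→σ₅ , covers , u≤ = search-improves d σ₄
        in σ₅ , _ , seq setSet (seq setSet run) ,
           progress-trans (progress-putSet 0<base (n≤1+n _))
             (progress-trans (progress-putSet z<s ≤-refl)
               (progress-weaken ≤-refl (m≤n+m (base d) 2) σ₄→σ₅)) ,
           (λ Y g → covers Y (subst₂ (λ A′ B′ → Isolated 𝓕 d A′ B′ Y) (sym cellA) (sym cellB) g)) ,
           +-monoʳ-≤ (extendTime n) (+-monoʳ-≤ (extendTime n) u≤)
        where
        kept : ∀ {l} → 2 + base d ≤ l → sets σ₂ l ≡ sets σ l
        kept l = trans (keepsSets σ₁→σ₂ l) (keepsSets σ→σ₁ l)
        σ₃ = putSet σ₂ (base d)
               (sets σ₂ (base (suc d)) ∪ single ∣ ints σ₂ (suc (base d)) ∣)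
        σ₄ = putSet σ₃ (suc (base d))
               (sets σ₃ (suc (base (suc d))) ∪ single ∣ ints σ₃ (base d) ∣)
        cellA : sets σ₄ (base d) ≡ A₀ ∪ single s
        cellA = trans (update-other (sets σ₃) _ (<⇒≢ ≤-refl))
          (trans (update-same (sets σ₂) (base d) _)
            (cong₂ (λ A′ z → A′ ∪ single ∣ z ∣) (kept ≤-refl)
              (trans (keepsInts σ₁→σ₂ ≤-refl) counterₛ)))
        cellB : sets σ₄ (suc (base d)) ≡ B₀ ∪ single t
        cellB = trans (update-same (sets σ₃) (suc (base d)) _)
          (cong₂ (λ B′ z → B′ ∪ single ∣ z ∣)
            (trans (update-other (sets σ₂) _ (≢-sym (<⇒≢ (m≤n+m (suc (base d)) 2)))) (kept (n≤1+n _)))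
            counterₜ)

      outer : ∀ s → s < n → ∀ σ₁ → Progress (2 + base d) (2 + base d) σ σ₁ → ints σ₁ (suc (base d)) ≡ + s →
        Improves (suc (base d)) (2 + base d) _ σ₁ (Gₛ s) _
      outer s s<n σ₁ σ→σ₁ counterₛ = for-improves {G = G s} (inner s σ₁ σ→σ₁ counterₛ)

-- Time bounds

private
  -- Inequalities with the difference of the two sides added on the left; here
  -- it is (n² − 2) K + 23 n² − 16 n − 7, expanded in m to avoid subtraction.
  level-bound : ∀ m w v → let n = 2 + m ; K = 2 * w + 32 in
    2 + (n * (2 + (n * (w + (w + v) + 9) + 5) + 9) + 5) + 2 * K
      + ((m * m + 4 * m + 2) * K + 23 * (m * m) + 76 * m + 53)
    ≡ n * (n * 1) * (v + 2 * K)
  level-bound = solve-∀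

  total-bound : ∀ n r γ → let s = suc n ; m = suc (s + γ) ; e = suc (s + 1)
                              E = m + (3 + (m + (3 + (e + (e + (3 + suc s)))))) in
    suc (6 * (2 + n + r)) + (suc (s + ((s + (s + s)) + s)) + E)
      + 2 * (2 * suc (s + (s + (s + 1))) + 32) + (suc s + (E + 3) + s)
      + (41 * n + 1 + 70 * r + 72 * γ)
    ≡ 76 * (2 + n + r + γ)
  total-bound = solve-∀

-- Added to `searchTime`, it turns the recursion into multiplication by `n ^ 2`: for `n ≥ 2` the
-- overhead of one level is at most `n ^ 2 - 1` times this constant.
levelConstant : ℕ → ℕ
levelConstant n = 2 * (2 * extendTime n + 32)

searchTime-bound : ∀ {n} γ τ d → 2 ≤ n →
  searchTime n γ τ d + levelConstant n ≤ n ^ (2 * d) * (leafTime n γ τ + levelConstant n)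
searchTime-bound γ τ zero _ = ≤-reflexive (sym (*-identityˡ _))
searchTime-bound {n@(suc (suc m))} γ τ (suc d) 2≤n@(s≤s (s≤s _)) = begin
  searchTime n γ τ (suc d) + levelConstant n
    ≤⟨ m≤m+n _ _ ⟩
  searchTime n γ τ (suc d) + levelConstant n + _
    ≡⟨ level-bound m (extendTime n) (searchTime n γ τ d) ⟩
  n ^ 2 * (searchTime n γ τ d + levelConstant n)
    ≤⟨ *-monoʳ-≤ (n ^ 2) (searchTime-bound γ τ d 2≤n) ⟩
  n ^ 2 * (n ^ (2 * d) * (leafTime n γ τ + levelConstant n))
    ≡⟨ *-assoc (n ^ 2) (n ^ (2 * d)) _ ⟨
  n ^ 2 * n ^ (2 * d) * (leafTime n γ τ + levelConstant n)
    ≡⟨ cong (_* (leafTime n γ τ + levelConstant n)) (^-distribˡ-+-* n 2 (2 * d)) ⟨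
  n ^ (2 + 2 * d) * (leafTime n γ τ + levelConstant n)
    ≡⟨ cong (λ x → n ^ x * (leafTime n γ τ + levelConstant n)) (*-suc 2 d) ⟨
  n ^ (2 * suc d) * (leafTime n γ τ + levelConstant n) ∎
  where open ≤-Reasoning

overhead : ℕ → ℕ → ℕ
overhead n γ = suc (suc n) + (examineTime n γ + 3) + suc n

-- The constant terms force 76: for `n = γ = 0` and `τ = 2` the left side is 151. With `r` the
-- excess of `τ` over `2 + n`, all other coefficients are smaller than 76.
overall-bound : ∀ {n τ} γ → 2 + n ≤ τ →
  leafTime n γ τ + levelConstant n + overhead n γ ≤ 76 * (τ + γ)
overall-bound {n} γ 2+n≤τ with m≤n⇒∃[o]m+o≡n 2+n≤τ
... | r , refl = ≤-trans (m≤m+n _ _) (≤-reflexive (total-bound n r γ))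

1≤n^ : ∀ {n} d → 1 ≤ n → 1 ≤ n ^ d
1≤n^ {n} d 1≤n = m^n>0 n d
  where instance _ = >-nonZero 1≤n

large-bound : ∀ {n γ τ t u v} k → 2 ≤ n → 2 + n ≤ τ → t ≤ examineTime n γ →
  u ≤ searchTime n γ τ k → v ≡ suc (suc n) + (t + (3 + u)) + suc n →
  v ≤ 76 * (n ^ (2 * k) * (τ + γ))
large-bound {n} {γ} {τ} {t} {u} k 2≤n 2+n≤τ t≤ u≤ refl = begin
  suc (suc n) + (t + (3 + u)) + suc n
    ≤⟨ +-monoˡ-≤ (suc n) (+-monoʳ-≤ (suc (suc n)) (+-mono-≤ t≤ (+-monoʳ-≤ 3 u≤))) ⟩
  suc (suc n) + (examineTime n γ + (3 + searchTime n γ τ k)) + suc n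
    ≡⟨ regroup (suc (suc n)) (examineTime n γ) (searchTime n γ τ k) (suc n) ⟩
  searchTime n γ τ k + overhead n γ
    ≤⟨ +-monoˡ-≤ (overhead n γ) (m≤m+n _ (levelConstant n)) ⟩
  searchTime n γ τ k + levelConstant n + overhead n γ
    ≤⟨ +-mono-≤ (searchTime-bound γ τ k 2≤n)
                (m≤n*m (overhead n γ) (n ^ (2 * k)) {{>-nonZero (1≤n^ (2 * k) (≤-trans (s≤s z≤n) 2≤n))}}) ⟩
  n ^ (2 * k) * (leafTime n γ τ + levelConstant n) + n ^ (2 * k) * overhead n γ
    ≡⟨ *-distribˡ-+ (n ^ (2 * k)) _ (overhead n γ) ⟨
  n ^ (2 * k) * (leafTime n γ τ + levelConstant n + overhead n γ)
    ≤⟨ *-monoʳ-≤ (n ^ (2 * k)) (overall-bound γ 2+n≤τ) ⟩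
  n ^ (2 * k) * (76 * (τ + γ))
    ≡⟨ swap (n ^ (2 * k)) (τ + γ) ⟩
  76 * (n ^ (2 * k) * (τ + γ)) ∎
  where
  open ≤-Reasoning
  regroup : ∀ a e u s → a + (e + (3 + u)) + s ≡ u + (a + (e + 3) + s)
  regroup = solve-∀
  swap : ∀ x y → x * (76 * y) ≡ 76 * (x * y)
  swap = solve-∀

small-bound : ∀ {n γ τ t v} k → 1 ≤ n → 2 + n ≤ τ → t ≤ examineTime n γ →
  v ≡ suc (suc n) + (t + (3 + 1)) + suc n → v ≤ 76 * (n ^ (2 * k) * (τ + γ))
small-bound {n} {γ} {τ} {t} k 1≤n 2+n≤τ t≤ refl = begin
  suc (suc n) + (t + 4) + suc n
    ≤⟨ +-monoˡ-≤ (suc n) (+-monoʳ-≤ (suc (suc n)) (+-monoˡ-≤ 4 t≤)) ⟩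
  suc (suc n) + (examineTime n γ + 4) + suc n
    ≡⟨ regroup (suc (suc n)) (examineTime n γ) (suc n) ⟩
  1 + overhead n γ
    -- The unit spent on `skip` is charged to a leaf that is never run.
    ≤⟨ +-monoˡ-≤ (overhead n γ) (s≤s z≤n) ⟩
  leafTime n γ τ + levelConstant n + overhead n γ
    ≤⟨ overall-bound γ 2+n≤τ ⟩
  76 * (τ + γ)
    ≤⟨ *-monoʳ-≤ 76 (m≤n*m (τ + γ) (n ^ (2 * k)) {{>-nonZero (1≤n^ (2 * k) 1≤n)}}) ⟩
  76 * (n ^ (2 * k) * (τ + γ)) ∎
  where
  open ≤-Reasoning
  regroup : ∀ a e s → a + (e + 4) + s ≡ 1 + (a + (e + 3) + s)
  regroup = solve-∀

-- Covering the whole family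

module _ {n : ℕ} (f : Subset n → ℤ) (f-submodular : Submodular f) (𝓕 : Family n) (γ : ℕ)
  {k : ℕ} (complement : IsComplementOfHierarchicalLattice k 𝓕)
  (S : Algorithm false) (τ : ℕ → ℕ) (S-minimizes : MinimizesSubmodularWithin S τ) where

  -- The empty set and the full set are separate cases because `isolate` picks its pairs from an
  -- element inside `Y` and one outside.
  covers-all : {X : Subset n} →
    (∀ Y → Covers f 𝓕 γ ⊥ Y → Covers f 𝓕 γ X Y) → (∀ Y → Covers f 𝓕 γ ⊤ Y → Covers f 𝓕 γ X Y) →
    (∀ Y → Y ∈ᶠ 𝓕 → Subset.Nonempty Y → Subset.Nonempty (∁ Y) → Covers f 𝓕 γ X Y) →
    Defs.Nonempty 𝓕 → IsMinimizer f 𝓕 X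
  covers-all {X} covers⊥ covers⊤ covers (Y₀ , Y₀∈𝓕) =
    proj₁ (covered Y₀ Y₀∈𝓕) , λ Y Y∈𝓕 → proj₂ (covered Y Y∈𝓕)
    where
    covered : ∀ Y → Y ∈ᶠ 𝓕 → Covers f 𝓕 γ X Y
    covered Y Y∈𝓕 with nonempty? Y | nonempty? (∁ Y)
    ... | no none | _       = covers⊥ Y (subst (λ Z → Covers f 𝓕 γ Z Y) (Empty-unique none) (Y∈𝓕 , ℤ.≤-refl))
    ... | yes _   | no none = covers⊤ Y (subst (λ Z → Covers f 𝓕 γ Z Y) (full-set none) (Y∈𝓕 , ℤ.≤-refl))
    ... | yes Y≢∅ | yes Y≢V = covers Y Y∈𝓕 Y≢∅ Y≢V

  searchAll-minimizes : 1 ≤ n →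
    MinimizesOverFamilyWithin (searchAll S k) f 𝓕 γ (76 * (n ^ (2 * k) * (τ n + γ)))
  searchAll-minimizes 1≤n
    with examine-improves f 𝓕 γ (putSet initial 1 ⊤)
  ... | σ , t , run , initial→σ , covers⊤ , t≤ with 2 ≤? n
  -- A one-element ground set has no nonempty proper subset, so the two trivial candidates suffice.
  ... | no n<2 = _ , _ ,
    done (seq setSet (seq run (ifFalse (≤ᵇ-false {+ 2} {+ n} λ { (ℤ.+≤+ 2≤n) → n<2 2≤n }) skip))) ,
    covers-all (Progress.keepsBest initial→σ) covers⊤
      (λ { Y _ (s , s∈Y) (t , t∈∁Y) →
        contradiction s∈Y (x∈∁p⇒x∉p (subst (_∈ ∁ Y) (fin≤1 (≤-pred (≰⇒> n<2)) t s) t∈∁Y)) }) ,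
    small-bound k 1≤n (n+2≤τ f 𝓕 γ S τ S-minimizes f-submodular) t≤ refl
  ... | yes 2≤n with search-improves f 𝓕 γ S τ S-minimizes f-submodular k σ
  ... | σ′ , u , run′ , σ→σ′ , covers , u≤ = _ , _ ,
    done (seq setSet (seq run (ifTrue (≤ᵇ-true (ℤ.+≤+ 2≤n)) run′))) ,
    -- The initial best set is `⊥`, so preservation of coverage already settles the case of the
    -- empty set.
    covers-all (λ Y → Progress.keepsBest σ→σ′ Y ∘ Progress.keepsBest initial→σ Y)
      (λ Y → Progress.keepsBest σ→σ′ Y ∘ covers⊤ Y)
      (λ Y Y∈𝓕 Y≢∅ Y≢V → covers Y (isolated Y Y∈𝓕 Y≢∅ Y≢V)) ,
    large-bound k 2≤n (n+2≤τ f 𝓕 γ S τ S-minimizes f-submodular) t≤ u≤ refl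
    where
    -- Nothing has been written to these cells yet, so the search starts from the interval of all
    -- subsets, which misses the empty family `chain 0`.
    cell≡⊥ : ∀ {i} → 3 ≤ i → sets σ i ≡ ⊥
    cell≡⊥ 3≤i@(s≤s (s≤s _)) = Progress.keepsSets initial→σ (≤-trans (s≤s z≤n) 3≤i)
    isolated : ∀ Y → Y ∈ᶠ 𝓕 → Subset.Nonempty Y → Subset.Nonempty (∁ Y) →
      Isolated 𝓕 k (sets σ (base k)) (sets σ (suc (base k))) Y
    isolated Y Y∈𝓕 Y≢∅ Y≢V
      rewrite cell≡⊥ {base k} (m≤n+m 3 _) | cell≡⊥ {suc (base k)} (m≤n⇒m≤1+n (m≤n+m 3 _)) =
      isolate complement Y∈𝓕 Y≢∅ Y≢V k 0 (+-identityʳ k)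
        (⊆-min Y , λ _ → x∉p⇒x∈∁p ∉⊥)
        (λ Z _ → HierarchicalLattice.bottom complement Z)

theorem2p3 : Σ[ C ∈ ℕ ]
    (∀ (k : ℕ) → 1 ≤ k →
    ∀ (A : Algorithm false) →
    Σ[ B ∈ Algorithm true ]
    (∀ (τ : ℕ → ℕ) → MinimizesSubmodularWithin A τ →
    ∀ (n : ℕ) → 1 ≤ n →
    ∀ (𝓕 : Family n) → IsComplementOfHierarchicalLattice k 𝓕 →
    ∀ (f : Subset n → ℤ) → Submodular f →
    ∀ (γ : ℕ) →
    MinimizesOverFamilyWithin B f 𝓕 γ (C * (n ^ (2 * k) * (τ n + γ)))))
theorem2p3 = 76 , λ k _ A → searchAll A k ,
  λ τ A-minimizes n 1≤n 𝓕 complement f f-submodular γ →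
  searchAll-minimizes f f-submodular 𝓕 γ complement A τ A-minimizes 1≤n
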